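{- Let $G_1$ and $G_2$ be two vertex-disjoint simple connected graphs with $|V(G_1)|=n_1$, $|V(G_2)|=n_2$, $|E(G_1)|=m_1$, $|E(G_2)|=m_2$. Then the vertex R-join $G_1\dot{\vee}_R G_2$ satisfies \[ F(G_1\dot{\vee}_R G_2)=8F(G_1)+F(G_2)+12n_2M_1(G_1)+3n_1M_1(G_2)+12m_1n_2^{2}+6m_2n_1^{2}+n_1n_2(n_1^2+n_2^2)+8m_1 . \]
   Context: For a simple graph $G$ and $v\in V(G)$, $d_G(v)$ is the degree of $v$. The first Zagreb index is $M_1(G)=\sum_{v\in V(G)}d_G(v)^2$ and the F-index is $F(G)=\sum_{v\in V(G)}d_G(v)^3$. The graph $R(G)$ is obtained from $G$ by inserting a new vertex into each edge of $G$ and joining each new vertex to the two end vertices of the corresponding edge (so the original edges of $G$ are kept); let $I(G)$ denote the set of these new vertices, so $V(R(G))=V(G)\cup I(G)$. The vertex R-join $G_1\dot{\vee}_R G_2$ is the graph obtained from $R(G_1)$ and $G_2$ (taken vertex-disjoint) by joining each vertex of $V(G_1)$ to every vertex of $G_2$ by an edge. -}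

module Defs where

open import Data.Empty using (⊥)
open import Data.Fin.Base using (Fin)
import Data.Fin.Properties as Fin
open import Data.List.Base
  using (List; []; _∷_; _++_; map; filter; length; lookup; allFin)
open import Data.List.Membership.Propositional using (_∈_)
open import Data.List.Membership.Propositional.Properties
  using (∈-map⁺; ∈-map⁻; ∈-++⁺ˡ; ∈-++⁺ʳ; ∈-allFin)
open import Data.List.Relation.Unary.Unique.Propositional using (Unique)
open import Data.List.Relation.Unary.Unique.Propositional.Properties
  using (map⁺; ++⁺; allFin⁺)
open import Data.Nat.Base using (ℕ; _^_)
open import Data.Nat.ListAction using (sum)
open import Data.Product.Base using (_×_; _,_; proj₁; proj₂; uncurry)
open import Data.Sum.Base using (_⊎_; inj₁; inj₂)
open import Data.Sum.Properties using (≡-dec; inj₁-injective; inj₂-injective)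
open import Data.Unit.Base using (⊤; tt)
open import Relation.Binary.Construct.Closure.ReflexiveTransitive using (Star)
open import Relation.Binary.Definitions
  using (Decidable; DecidableEquality; Symmetric)
open import Relation.Binary.PropositionalEquality using (_≡_; refl)
open import Relation.Nullary.Decidable.Core using (yes; no; _⊎-dec_)
open import Relation.Nullary.Negation.Core using (¬_)
import Relation.Unary as Unary

private variable
  A B : Set

-- Every two-element subset of a duplicate-free list occurs exactly once,
-- in one of its two orders.
pairs : List A → List (A × A)
pairs []       = []
pairs (x ∷ xs) = map (x ,_) xs ++ pairs xs

record SimpleGraph : Set₁ where
  infix 4 _≟_
  field
    Vertex   : Set
    _≟_      : DecidableEquality Vertex
    vertices : List Vertex
    unique   : Unique vertices
    complete : ∀ v → v ∈ vertices
    Adj      : Vertex → Vertex → Set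
    adj?     : Decidable Adj
    adj-sym  : Symmetric Adj
    irrefl   : ∀ {v} → ¬ Adj v v

  edges : List (Vertex × Vertex)
  edges = filter (uncurry adj?) (pairs vertices)

  order : ℕ
  order = length vertices

  size : ℕ
  size = length edges

  degree : Vertex → ℕ
  degree v = length (filter (adj? v) vertices)

open SimpleGraph using (Vertex; vertices; order; size; degree)

record Connected (G : SimpleGraph) : Set where
  open SimpleGraph G using (Adj)
  field
    nonempty : Vertex G
    path     : (u v : Vertex G) → Star Adj u v

M₁ : SimpleGraph → ℕ
M₁ G = sum (map (λ v → degree G v ^ 2) (vertices G))

F : SimpleGraph → ℕ
F G = sum (map (λ v → degree G v ^ 3) (vertices G))

private
  ⊎-list : List A → List B → List (A ⊎ B)
  ⊎-list xs ys = map inj₁ xs ++ map inj₂ ys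

  ⊎-unique : {xs : List A} {ys : List B} →
             Unique xs → Unique ys → Unique (⊎-list xs ys)
  ⊎-unique {A = A} {B = B} {xs} {ys} uxs uys =
    ++⁺ (map⁺ inj₁-injective uxs) (map⁺ inj₂-injective uys) disjoint
    where
    inj₁≢inj₂ : {z : A ⊎ B} {a : A} {b : B} → z ≡ inj₁ a → ¬ (z ≡ inj₂ b)
    inj₁≢inj₂ refl ()

    disjoint : {z : A ⊎ B} → ¬ (z ∈ map inj₁ xs × z ∈ map inj₂ ys)
    disjoint (p , q) =
      inj₁≢inj₂ (proj₂ (proj₂ (∈-map⁻ inj₁ p))) (proj₂ (proj₂ (∈-map⁻ inj₂ q)))

  ⊎-complete : {xs : List A} {ys : List B} → (∀ a → a ∈ xs) → (∀ b → b ∈ ys) →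
               ∀ z → z ∈ ⊎-list xs ys
  ⊎-complete           cxs cys (inj₁ a) = ∈-++⁺ˡ (∈-map⁺ inj₁ (cxs a))
  ⊎-complete {xs = xs} cxs cys (inj₂ b) = ∈-++⁺ʳ (map inj₁ xs) (∈-map⁺ inj₂ (cys b))

module _ (G : SimpleGraph) where
  private module G = SimpleGraph G

  -- The set I(G) of inserted vertices: one for each position in the edge list.
  I : Set
  I = Fin G.size

  EndOf : G.Vertex → I → Set
  EndOf v i = v ≡ proj₁ (lookup G.edges i) ⊎ v ≡ proj₂ (lookup G.edges i)

  R-Adj : G.Vertex ⊎ I → G.Vertex ⊎ I → Set
  R-Adj (inj₁ u) (inj₁ v) = G.Adj u v
  R-Adj (inj₁ u) (inj₂ i) = EndOf u i
  R-Adj (inj₂ i) (inj₁ v) = EndOf v i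
  R-Adj (inj₂ _) (inj₂ _) = ⊥

  private
    endOf? : Decidable EndOf
    endOf? v i =
      (v G.≟ proj₁ (lookup G.edges i)) ⊎-dec (v G.≟ proj₂ (lookup G.edges i))

    R-adj? : Decidable R-Adj
    R-adj? (inj₁ u) (inj₁ v) = G.adj? u v
    R-adj? (inj₁ u) (inj₂ i) = endOf? u i
    R-adj? (inj₂ i) (inj₁ v) = endOf? v i
    R-adj? (inj₂ _) (inj₂ _) = no λ ()

    R-sym : Symmetric R-Adj
    R-sym {inj₁ _} {inj₁ _} p = G.adj-sym p
    R-sym {inj₁ _} {inj₂ _} p = p
    R-sym {inj₂ _} {inj₁ _} p = p
    R-sym {inj₂ _} {inj₂ _} ()

    R-irrefl : ∀ {x} → ¬ R-Adj x x
    R-irrefl {inj₁ _} p = G.irrefl p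
    R-irrefl {inj₂ _} ()

  R : SimpleGraph
  R = record
    { Vertex   = G.Vertex ⊎ I
    ; _≟_      = ≡-dec G._≟_ Fin._≟_
    ; vertices = ⊎-list G.vertices (allFin G.size)
    ; unique   = ⊎-unique G.unique (allFin⁺ G.size)
    ; complete = ⊎-complete G.complete ∈-allFin
    ; Adj      = R-Adj
    ; adj?     = R-adj?
    ; adj-sym  = λ {x} {y} → R-sym {x} {y}
    ; irrefl   = λ {x} → R-irrefl {x}
    }

module _ (G₁ G₂ : SimpleGraph) where
  private
    module R₁ = SimpleGraph (R G₁)
    module G₂ = SimpleGraph G₂

  Original : R₁.Vertex → Set
  Original (inj₁ _) = ⊤
  Original (inj₂ _) = ⊥

  -- The disjoint sum makes the two graphs vertex-disjoint.
  Join-Adj : R₁.Vertex ⊎ G₂.Vertex → R₁.Vertex ⊎ G₂.Vertex → Set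
  Join-Adj (inj₁ x) (inj₁ y) = R₁.Adj x y
  Join-Adj (inj₁ x) (inj₂ _) = Original x
  Join-Adj (inj₂ _) (inj₁ y) = Original y
  Join-Adj (inj₂ v) (inj₂ w) = G₂.Adj v w

  private
    original? : Unary.Decidable Original
    original? (inj₁ _) = yes tt
    original? (inj₂ _) = no λ ()

    join-adj? : Decidable Join-Adj
    join-adj? (inj₁ x) (inj₁ y) = R₁.adj? x y
    join-adj? (inj₁ x) (inj₂ _) = original? x
    join-adj? (inj₂ _) (inj₁ y) = original? y
    join-adj? (inj₂ v) (inj₂ w) = G₂.adj? v w

    join-sym : Symmetric Join-Adj
    join-sym {inj₁ x} {inj₁ y} p = R₁.adj-sym {x} {y} p
    join-sym {inj₁ _} {inj₂ _} p = p
    join-sym {inj₂ _} {inj₁ _} p = p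
    join-sym {inj₂ _} {inj₂ _} p = G₂.adj-sym p

    join-irrefl : ∀ {x} → ¬ Join-Adj x x
    join-irrefl {inj₁ x} p = R₁.irrefl {x} p
    join-irrefl {inj₂ _} p = G₂.irrefl p

  vertexRJoin : SimpleGraph
  vertexRJoin = record
    { Vertex   = R₁.Vertex ⊎ G₂.Vertex
    ; _≟_      = ≡-dec R₁._≟_ G₂._≟_
    ; vertices = ⊎-list R₁.vertices G₂.vertices
    ; unique   = ⊎-unique R₁.unique G₂.unique
    ; complete = ⊎-complete R₁.complete G₂.complete
    ; Adj      = Join-Adj
    ; adj?     = join-adj?
    ; adj-sym  = λ {x} {y} → join-sym {x} {y}
    ; irrefl   = λ {x} → join-irrefl {x}
    }

{-# OPTIONS --safe #-}
-- With every vertex sum weighted by 0/1 indicators, the whole count rests on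
-- one double counting: for any weight g on the vertices,
--   Σ_{uv ∈ E} (g u + g v) = Σ_v g v · d(v).
-- For g = 1 it is the handshake identity, for g the indicator of a vertex v it
-- says that v lies on d(v) edges.  Hence in the join an original vertex v of G₁
-- has degree 2 d(v) + n₂, an inserted vertex has degree 2, and a vertex v of
-- G₂ has degree d(v) + n₁; it remains to expand the cubes.
module Submission where

open import Defs
open import Data.Bool.Base using (if_then_else_; true; false)
open import Data.List.Base
  using (List; []; _∷_; _++_; map; filter; length; lookup; allFin; tabulate)
open import Data.List.Membership.Propositional using (_∈_)
open import Data.List.Membership.Propositional.Properties using (∈-lookup)
open import Data.List.Properties
  using (map-++; map-∘; map-tabulate; tabulate-lookup; length-tabulate)
open import Data.List.Relation.Unary.All as All using (All; []; _∷_)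
open import Data.List.Relation.Unary.All.Properties using (all-filter)
open import Data.List.Relation.Unary.AllPairs using ([]; _∷_)
open import Data.List.Relation.Unary.Any using (here; there)
open import Data.List.Relation.Unary.Unique.Propositional using (Unique)
open import Data.Nat.Base using (ℕ; _+_; _*_; _^_)
open import Data.Nat.ListAction using (sum)
open import Data.Nat.ListAction.Properties using (sum-++)
open import Data.Nat.Properties
  using (+-identityʳ; *-identityʳ; *-identityˡ; *-zeroʳ)
open import Data.Nat.Solver using (module +-*-Solver)
open import Data.Product.Base using (_×_; _,_; proj₁; proj₂; uncurry)
open import Data.Sum.Base using (_⊎_; inj₁; inj₂)
open import Function.Base using (_∘_; id)
open import Relation.Binary.PropositionalEquality
  using (_≡_; refl; sym; trans; cong; cong₂; module ≡-Reasoning)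
open import Relation.Nullary.Decidable.Core using (Dec; does; yes; no; _⊎-dec_)
open import Relation.Nullary.Negation.Core using (¬_; contradiction)
open import Relation.Unary using (Decidable)

open SimpleGraph using (vertices; degree; adj?)
open ≡-Reasoning
open +-*-Solver using (solve; _:=_; _:+_; _:*_; _:^_; con)

private variable
  A B P Q : Set

-- Indicators of decidable propositions.

𝟙 : Dec P → ℕ
𝟙 P? = if does P? then 1 else 0

𝟙-true : (P? : Dec P) → P → 𝟙 P? ≡ 1
𝟙-true (yes _) _ = refl
𝟙-true (no ¬p) p = contradiction p ¬p

𝟙-false : (P? : Dec P) → ¬ P → 𝟙 P? ≡ 0
𝟙-false (yes p) ¬p = contradiction p ¬p
𝟙-false (no _)  _  = refl

𝟙-cong : (P? : Dec P) (Q? : Dec Q) → (P → Q) → (Q → P) → 𝟙 P? ≡ 𝟙 Q?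
𝟙-cong (yes p) Q? f _ = sym (𝟙-true Q? (f p))
𝟙-cong (no ¬p) Q? _ g = sym (𝟙-false Q? (¬p ∘ g))

-- Exclusivity rules out the one case where the sides differ, 1 against 2.
𝟙-⊎ : (P? : Dec P) (Q? : Dec Q) → (P → ¬ Q) → 𝟙 (P? ⊎-dec Q?) ≡ 𝟙 P? + 𝟙 Q?
𝟙-⊎ (yes p) Q? p⇒¬q = cong (1 +_) (sym (𝟙-false Q? (p⇒¬q p)))
𝟙-⊎ (no _)  _  _    = refl

-- Finite sums over lists, up to weighted double counting over unordered pairs.

∑ : (A → ℕ) → List A → ℕ
∑ f xs = sum (map f xs)

∑-cong : {f g : A → ℕ} → (∀ x → f x ≡ g x) → ∀ xs → ∑ f xs ≡ ∑ g xs
∑-cong f≗g []       = refl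
∑-cong f≗g (x ∷ xs) = cong₂ _+_ (f≗g x) (∑-cong f≗g xs)

∑-const : ∀ c (xs : List A) → ∑ (λ _ → c) xs ≡ length xs * c
∑-const c []       = refl
∑-const c (_ ∷ xs) = cong (c +_) (∑-const c xs)

∑-zero : {f : A → ℕ} {xs : List A} → All (λ x → f x ≡ 0) xs → ∑ f xs ≡ 0
∑-zero []            = refl
∑-zero (fx≡0 ∷ fs≡0) = cong₂ _+_ fx≡0 (∑-zero fs≡0)

∑-+ : ∀ (f g : A → ℕ) xs → ∑ (λ x → f x + g x) xs ≡ ∑ f xs + ∑ g xs
∑-+ f g []       = refl
∑-+ f g (x ∷ xs) = trans (cong (f x + g x +_) (∑-+ f g xs))
  (solve 4 (λ a b c d → (a :+ b) :+ (c :+ d) := (a :+ c) :+ (b :+ d))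
    refl (f x) (g x) (∑ f xs) (∑ g xs))

∑-*ˡ : ∀ c (f : A → ℕ) xs → ∑ (λ x → c * f x) xs ≡ c * ∑ f xs
∑-*ˡ c f []       = sym (*-zeroʳ c)
∑-*ˡ c f (x ∷ xs) = trans (cong (c * f x +_) (∑-*ˡ c f xs))
  (solve 3 (λ c a b → c :* a :+ c :* b := c :* (a :+ b)) refl c (f x) (∑ f xs))

∑-map : ∀ (f : B → ℕ) (g : A → B) xs → ∑ f (map g xs) ≡ ∑ (f ∘ g) xs
∑-map f g xs = cong sum (sym (map-∘ xs))

∑-++ : ∀ (f : A → ℕ) xs ys → ∑ f (xs ++ ys) ≡ ∑ f xs + ∑ f ys
∑-++ f xs ys = trans (cong sum (map-++ f xs ys)) (sum-++ (map f xs) (map f ys))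

∑-⊎ : ∀ (f : A ⊎ B → ℕ) xs ys →
      ∑ f (map inj₁ xs ++ map inj₂ ys) ≡ ∑ (f ∘ inj₁) xs + ∑ (f ∘ inj₂) ys
∑-⊎ f xs ys = trans (∑-++ f (map inj₁ xs) (map inj₂ ys))
                    (cong₂ _+_ (∑-map f inj₁ xs) (∑-map f inj₂ ys))

-- Inserted vertices are positions in the edge list; this turns a sum over them into a sum over the
-- edges themselves.
∑-lookup : ∀ (f : A → ℕ) xs → ∑ (f ∘ lookup xs) (allFin (length xs)) ≡ ∑ f xs
∑-lookup f xs = begin
  ∑ (f ∘ lookup xs) (allFin (length xs))      ≡⟨ ∑-map f (lookup xs) (allFin (length xs)) ⟨
  ∑ f (map (lookup xs) (allFin (length xs)))  ≡⟨ cong (∑ f) (map-tabulate id (lookup xs)) ⟩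
  ∑ f (tabulate (lookup xs))   ≡⟨ cong (∑ f) (tabulate-lookup xs) ⟩
  ∑ f xs                                      ∎

∑-filter : {P : A → Set} (P? : Decidable P) (f : A → ℕ) → ∀ xs →
           ∑ f (filter P? xs) ≡ ∑ (λ x → 𝟙 (P? x) * f x) xs
∑-filter P? f []       = refl
∑-filter P? f (x ∷ xs) with does (P? x)
-- `filter` and `𝟙` both branch on `does (P? x)`, so one abstraction evaluates both sides.
... | true  = cong₂ _+_ (sym (*-identityˡ (f x))) (∑-filter P? f xs)
... | false = ∑-filter P? f xs

length-filter-∑ : {P : A → Set} (P? : Decidable P) → ∀ xs →
                  length (filter P? xs) ≡ ∑ (𝟙 ∘ P?) xs
length-filter-∑ P? xs = begin
  length (filter P? xs)             ≡⟨ *-identityʳ _ ⟨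
  length (filter P? xs) * 1         ≡⟨ ∑-const 1 (filter P? xs) ⟨
  ∑ (λ _ → 1) (filter P? xs)        ≡⟨ ∑-filter P? (λ _ → 1) xs ⟩
  ∑ (λ x → 𝟙 (P? x) * 1) xs         ≡⟨ ∑-cong (λ x → *-identityʳ (𝟙 (P? x))) xs ⟩
  ∑ (𝟙 ∘ P?) xs                     ∎

-- Summation against a Kronecker delta: `Unique` makes `v` contribute exactly once. Keeping `P`
-- abstract serves both orientations of the equality test, `v ≟ x` and `x ≟ v`.
∑-single : {P : A → Set} (P? : Decidable P) (f : A → ℕ) {v : A} {xs : List A} →
           P v → (∀ {x} → P x → x ≡ v) → Unique xs → v ∈ xs →
           ∑ (λ x → 𝟙 (P? x) * f x) xs ≡ f v
∑-single P? f {v} {x ∷ xs} pv P⇒≡v (v∉xs ∷ _) (here refl) = begin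
  𝟙 (P? v) * f v + ∑ (λ y → 𝟙 (P? y) * f y) xs
    ≡⟨ cong₂ _+_ (cong (_* f v) (𝟙-true (P? v) pv))
         (∑-zero (All.map (λ {y} v≢y → cong (_* f y)
           (𝟙-false (P? y) (v≢y ∘ sym ∘ P⇒≡v))) v∉xs)) ⟩
  1 * f v + 0  ≡⟨ trans (+-identityʳ _) (*-identityˡ (f v)) ⟩
  f v          ∎
∑-single P? f {v} {x ∷ xs} pv P⇒≡v (x∉xs ∷ xs!) (there v∈xs) =
  cong₂ _+_ (cong (_* f x) (𝟙-false (P? x) (All.lookup x∉xs v∈xs ∘ P⇒≡v)))
            (∑-single P? f pv P⇒≡v xs! v∈xs)

-- The right side sums all entries `g x * w x y` of a square matrix. Its diagonal vanishes, and by
-- symmetry of `w` each pair on the left supplies the two mirror entries off the diagonal. The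
-- induction adds the row and the column of the head `x`.
∑-pairs : (w : A → A → ℕ) → (∀ x y → w x y ≡ w y x) → (∀ x → w x x ≡ 0) →
          (g : A → ℕ) → ∀ xs →
          ∑ (λ (x , y) → w x y * (g x + g y)) (pairs xs) ≡ ∑ (λ x → g x * ∑ (w x) xs) xs
∑-pairs w w-sym w-irr g []       = refl
∑-pairs w w-sym w-irr g (x ∷ xs) = begin
  ∑ h (map (x ,_) xs ++ pairs xs)
    ≡⟨ ∑-++ h (map (x ,_) xs) (pairs xs) ⟩
  ∑ h (map (x ,_) xs) + ∑ h (pairs xs)
    ≡⟨ cong₂ _+_ (∑-map h (x ,_) xs) (∑-pairs w w-sym w-irr g xs) ⟩
  ∑ (λ y → w x y * (g x + g y)) xs + T
    -- Symmetry is applied to the second summand only, so that it becomes the entry in row `y` and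
    -- column `x`.
    ≡⟨ cong (_+ T) (∑-cong (λ y → trans
         (solve 3 (λ w a b → w :* (a :+ b) := a :* w :+ b :* w) refl (w x y) (g x) (g y))
         (cong (λ z → g x * w x y + g y * z) (w-sym x y))) xs) ⟩
  ∑ (λ y → g x * w x y + g y * w y x) xs + T
    ≡⟨ cong (_+ T) (∑-+ (λ y → g x * w x y) (λ y → g y * w y x) xs) ⟩
  ∑ (λ y → g x * w x y) xs + S + T
    ≡⟨ cong (λ z → z + S + T) (∑-*ˡ (g x) (w x) xs) ⟩
  g x * ∑ (w x) xs + S + T
    ≡⟨ solve 3 (λ a b c → a :+ b :+ c := a :+ (b :+ c)) refl (g x * ∑ (w x) xs) S T ⟩
  g x * ∑ (w x) xs + (S + T)
    -- The zero `w x x` is inserted to complete the row of `x`, and the column `S` is distributed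
    -- over the rows collected in `T`.
    ≡⟨ cong₂ _+_ (cong (λ z → g x * (z + ∑ (w x) xs)) (sym (w-irr x)))
         (trans (sym (∑-+ (λ y → g y * w y x) (λ y → g y * ∑ (w y) xs) xs))
           (∑-cong (λ y → solve 3 (λ a b c → a :* b :+ a :* c := a :* (b :+ c))
             refl (g y) (w y x) (∑ (w y) xs)) xs)) ⟩
  ∑ (λ y → g y * ∑ (w y) (x ∷ xs)) (x ∷ xs) ∎
  where
  h = λ (x , y) → w x y * (g x + g y)
  S = ∑ (λ y → g y * w y x) xs
  T = ∑ (λ y → g y * ∑ (w y) xs) xs

-- Edge sums of a graph, degrees in `R G`, and sums of cubes.

module _ (G : SimpleGraph) where
  private module G = SimpleGraph G

  degree-∑ : ∀ v → G.degree v ≡ ∑ (λ u → 𝟙 (G.adj? v u)) G.vertices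
  degree-∑ v = length-filter-∑ (G.adj? v) G.vertices

  ∑-edges : (g : G.Vertex → ℕ) →
            ∑ (λ (u , v) → g u + g v) G.edges ≡ ∑ (λ v → g v * G.degree v) G.vertices
  ∑-edges g = begin
    ∑ (λ (u , v) → g u + g v) G.edges
      ≡⟨ ∑-filter (uncurry G.adj?) _ (pairs G.vertices) ⟩
    ∑ (λ (u , v) → 𝟙 (G.adj? u v) * (g u + g v)) (pairs G.vertices)
      ≡⟨ ∑-pairs (λ u v → 𝟙 (G.adj? u v))
           (λ u v → 𝟙-cong (G.adj? u v) (G.adj? v u) G.adj-sym G.adj-sym)
           (λ v → 𝟙-false (G.adj? v v) G.irrefl) g G.vertices ⟩
    ∑ (λ v → g v * ∑ (λ u → 𝟙 (G.adj? v u)) G.vertices) G.vertices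
      ≡⟨ ∑-cong (λ v → cong (g v *_) (degree-∑ v)) G.vertices ⟨
    ∑ (λ v → g v * G.degree v) G.vertices ∎

  handshake : ∑ G.degree G.vertices ≡ G.size * 2
  handshake = begin
    ∑ G.degree G.vertices                ≡⟨ ∑-cong (λ v → *-identityˡ (G.degree v)) G.vertices ⟨
    ∑ (λ v → 1 * G.degree v) G.vertices  ≡⟨ ∑-edges (λ _ → 1) ⟨
    ∑ (λ _ → 2) G.edges                  ≡⟨ ∑-const 2 G.edges ⟩
    G.size * 2                           ∎

  -- Every listed edge has passed the adjacency filter, so irreflexivity applies. This makes the two
  -- alternatives of `EndOf` exclusive, as `𝟙-endOf` requires.
  endpoints-distinct : ∀ i → ¬ proj₁ (lookup G.edges i) ≡ proj₂ (lookup G.edges i)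
  endpoints-distinct i = adj⇒≢
    (All.lookup (all-filter (uncurry G.adj?) (pairs G.vertices)) (∈-lookup i))
    where
    adj⇒≢ : ∀ {u v} → G.Adj u v → ¬ u ≡ v
    adj⇒≢ uv refl = G.irrefl uv

  𝟙-endOf : ∀ v i →
            𝟙 (adj? (R G) (inj₁ v) (inj₂ i)) ≡
            𝟙 (v G.≟ proj₁ (lookup G.edges i)) + 𝟙 (v G.≟ proj₂ (lookup G.edges i))
  𝟙-endOf v i = 𝟙-⊎ (v G.≟ _) (v G.≟ _) (λ p q → endpoints-distinct i (trans (sym p) q))

  -- With the indicator of `v` as weight in `∑-edges`, the edge side counts the edges at `v` and the
  -- vertex side collapses to its term at `v`.
  ∑-inserted : ∀ v → ∑ (λ i → 𝟙 (adj? (R G) (inj₁ v) (inj₂ i))) (allFin G.size) ≡ G.degree v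
  ∑-inserted v = begin
    ∑ (λ i → 𝟙 (adj? (R G) (inj₁ v) (inj₂ i))) (allFin G.size)
      ≡⟨ ∑-cong (𝟙-endOf v) (allFin G.size) ⟩
    ∑ (h ∘ lookup G.edges) (allFin G.size)
      ≡⟨ ∑-lookup h G.edges ⟩
    ∑ h G.edges
      ≡⟨ ∑-edges (λ u → 𝟙 (v G.≟ u)) ⟩
    ∑ (λ u → 𝟙 (v G.≟ u) * G.degree u) G.vertices
      ≡⟨ ∑-single (v G.≟_) G.degree refl sym G.unique (G.complete v) ⟩
    G.degree v ∎
    where
    h : G.Vertex × G.Vertex → ℕ
    h (a , b) = 𝟙 (v G.≟ a) + 𝟙 (v G.≟ b)

  ∑-≟ : ∀ a → ∑ (λ v → 𝟙 (v G.≟ a)) G.vertices ≡ 1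
  ∑-≟ a = trans (∑-cong (λ v → sym (*-identityʳ (𝟙 (v G.≟ a)))) G.vertices)
                (∑-single (G._≟ a) (λ _ → 1) refl id G.unique (G.complete a))

  -- The old neighbours and the adjacent inserted vertices each number `G.degree v`.
  degree-R-original : ∀ v → degree (R G) (inj₁ v) ≡ 2 * G.degree v
  degree-R-original v = begin
    degree (R G) (inj₁ v)
      ≡⟨ length-filter-∑ (adj? (R G) (inj₁ v)) (vertices (R G)) ⟩
    ∑ (λ x → 𝟙 (adj? (R G) (inj₁ v) x)) (vertices (R G))
      ≡⟨ ∑-⊎ _ G.vertices (allFin G.size) ⟩
    ∑ (λ u → 𝟙 (G.adj? v u)) G.vertices
      + ∑ (λ i → 𝟙 (adj? (R G) (inj₁ v) (inj₂ i))) (allFin G.size)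
      ≡⟨ cong₂ _+_ (sym (degree-∑ v)) (∑-inserted v) ⟩
    G.degree v + G.degree v
      ≡⟨ cong (G.degree v +_) (+-identityʳ (G.degree v)) ⟨
    2 * G.degree v ∎

  degree-R-inserted : ∀ i → degree (R G) (inj₂ i) ≡ 2
  degree-R-inserted i = begin
    degree (R G) (inj₂ i)
      ≡⟨ length-filter-∑ (adj? (R G) (inj₂ i)) (vertices (R G)) ⟩
    ∑ (λ x → 𝟙 (adj? (R G) (inj₂ i) x)) (vertices (R G))
      ≡⟨ ∑-⊎ _ G.vertices (allFin G.size) ⟩
    ∑ (λ v → 𝟙 (adj? (R G) (inj₂ i) (inj₁ v))) G.vertices + ∑ (λ _ → 0) (allFin G.size)
      -- Both orders of the adjacency test reduce to the same decision of `EndOf v i`, so `𝟙-endOf`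
      -- also applies with the inserted vertex first.
      ≡⟨ cong₂ _+_ (∑-cong (λ v → 𝟙-endOf v i) G.vertices)
           (trans (∑-const 0 (allFin G.size)) (*-zeroʳ (length (allFin G.size)))) ⟩
    ∑ (λ v → 𝟙 (v G.≟ proj₁ (lookup G.edges i)) + 𝟙 (v G.≟ proj₂ (lookup G.edges i))) G.vertices + 0
      ≡⟨ +-identityʳ _ ⟩
    ∑ (λ v → 𝟙 (v G.≟ proj₁ (lookup G.edges i)) + 𝟙 (v G.≟ proj₂ (lookup G.edges i))) G.vertices
      ≡⟨ ∑-+ _ _ G.vertices ⟩
    ∑ (λ v → 𝟙 (v G.≟ proj₁ (lookup G.edges i))) G.vertices
      + ∑ (λ v → 𝟙 (v G.≟ proj₂ (lookup G.edges i))) G.vertices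
      ≡⟨ cong₂ _+_ (∑-≟ _) (∑-≟ _) ⟩
    2 ∎

  -- One binomial expansion covers both sides of the join: `a = 2` for `G₁` and `a = 1` for `G₂`,
  -- with `n` the order of the other graph. The handshake identity turns the linear coefficient 3
  -- into 6.
  ∑-cubes : ∀ a n → ∑ (λ v → (a * G.degree v + n) ^ 3) G.vertices ≡
            a ^ 3 * F G + 3 * a ^ 2 * n * M₁ G + 6 * a * n ^ 2 * G.size + G.order * n ^ 3
  ∑-cubes a n = begin
    ∑ (λ v → (a * d v + n) ^ 3) V
      ≡⟨ ∑-cong (λ v → solve 3 (λ a n d → (a :* d :+ n) :^ 3 :=
           a :^ 3 :* d :^ 3 :+ con 3 :* a :^ 2 :* n :* d :^ 2 :+ con 3 :* a :* n :^ 2 :* d :+ n :^ 3)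
           refl a n (d v)) V ⟩
    ∑ (λ v → a ^ 3 * d v ^ 3 + 3 * a ^ 2 * n * d v ^ 2 + 3 * a * n ^ 2 * d v + n ^ 3) V
      ≡⟨ trans (∑-+ _ _ V) (cong₂ _+_ (trans (∑-+ _ _ V) (cong₂ _+_ (trans (∑-+ _ _ V)
           (cong₂ _+_ (∑-*ˡ (a ^ 3) _ V) (∑-*ˡ (3 * a ^ 2 * n) _ V)))
           (trans (∑-*ˡ (3 * a * n ^ 2) d V) (cong (3 * a * n ^ 2 *_) handshake))))
           (∑-const (n ^ 3) V)) ⟩
    a ^ 3 * F G + 3 * a ^ 2 * n * M₁ G + 3 * a * n ^ 2 * (G.size * 2) + G.order * n ^ 3
      ≡⟨ cong (λ z → a ^ 3 * F G + 3 * a ^ 2 * n * M₁ G + z + G.order * n ^ 3)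
           (solve 3 (λ a n m → con 3 :* a :* n :^ 2 :* (m :* con 2) := con 6 :* a :* n :^ 2 :* m)
             refl a n G.size) ⟩
    a ^ 3 * F G + 3 * a ^ 2 * n * M₁ G + 6 * a * n ^ 2 * G.size + G.order * n ^ 3 ∎
    where
    d = G.degree
    V = G.vertices

-- Degrees in the vertex R-join and the resulting F-index.

module _ (G₁ G₂ : SimpleGraph) where
  private
    module G₁ = SimpleGraph G₁
    module G₂ = SimpleGraph G₂
    module R₁ = SimpleGraph (R G₁)
    module J  = SimpleGraph (vertexRJoin G₁ G₂)

  degree-join : ∀ x → J.degree x ≡
                ∑ (λ y → 𝟙 (J.adj? x (inj₁ y))) R₁.vertices
                  + ∑ (λ y → 𝟙 (J.adj? x (inj₂ y))) G₂.vertices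
  degree-join x = trans (length-filter-∑ (J.adj? x) J.vertices) (∑-⊎ _ R₁.vertices G₂.vertices)

  degree-join-original : ∀ v → J.degree (inj₁ (inj₁ v)) ≡ 2 * G₁.degree v + G₂.order
  degree-join-original v = trans (degree-join (inj₁ (inj₁ v))) (cong₂ _+_
    (trans (sym (degree-∑ (R G₁) (inj₁ v))) (degree-R-original G₁ v))
    (trans (∑-const 1 G₂.vertices) (*-identityʳ G₂.order)))

  -- Only original vertices are joined to `G₂`, so the degree in `R G₁` is unchanged.
  degree-join-inserted : ∀ i → J.degree (inj₁ (inj₂ i)) ≡ 2
  degree-join-inserted i = trans (degree-join (inj₁ (inj₂ i))) (cong₂ _+_
    (trans (sym (degree-∑ (R G₁) (inj₂ i))) (degree-R-inserted G₁ i))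
    (trans (∑-const 0 G₂.vertices) (*-zeroʳ G₂.order)))

  -- Of the vertices of `R G₁`, the originals contribute 1 each and the inserted ones 0. The factor
  -- `1` fits the shape of `∑-cubes` at `a = 1`.
  degree-join-right : ∀ v → J.degree (inj₂ v) ≡ 1 * G₂.degree v + G₁.order
  degree-join-right v = begin
    J.degree (inj₂ v)
      ≡⟨ degree-join (inj₂ v) ⟩
    ∑ (λ x → 𝟙 (J.adj? (inj₂ v) (inj₁ x))) R₁.vertices + ∑ (λ u → 𝟙 (G₂.adj? v u)) G₂.vertices
      ≡⟨ cong₂ _+_ (∑-⊎ _ G₁.vertices (allFin G₁.size)) (sym (degree-∑ G₂ v)) ⟩
    ∑ (λ _ → 1) G₁.vertices + ∑ (λ _ → 0) (allFin G₁.size) + G₂.degree v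
      ≡⟨ cong (_+ G₂.degree v) (cong₂ _+_ (∑-const 1 G₁.vertices) (∑-const 0 (allFin G₁.size))) ⟩
    G₁.order * 1 + length (allFin G₁.size) * 0 + G₂.degree v
      ≡⟨ solve 3 (λ n l d → n :* con 1 :+ l :* con 0 :+ d := con 1 :* d :+ n)
           refl G₁.order (length (allFin G₁.size)) (G₂.degree v) ⟩
    1 * G₂.degree v + G₁.order ∎

  F-join : F (vertexRJoin G₁ G₂) ≡
           ∑ (λ v → (2 * G₁.degree v + G₂.order) ^ 3) G₁.vertices + G₁.size * 8
             + ∑ (λ v → (1 * G₂.degree v + G₁.order) ^ 3) G₂.vertices
  F-join = begin
    ∑ (λ x → J.degree x ^ 3) J.vertices
      ≡⟨ ∑-⊎ _ R₁.vertices G₂.vertices ⟩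
    ∑ (λ x → J.degree (inj₁ x) ^ 3) R₁.vertices + ∑ (λ v → J.degree (inj₂ v) ^ 3) G₂.vertices
      ≡⟨ cong (_+ ∑ (λ v → J.degree (inj₂ v) ^ 3) G₂.vertices) (∑-⊎ _ G₁.vertices (allFin G₁.size)) ⟩
    ∑ (λ v → J.degree (inj₁ (inj₁ v)) ^ 3) G₁.vertices
      + ∑ (λ i → J.degree (inj₁ (inj₂ i)) ^ 3) (allFin G₁.size)
      + ∑ (λ v → J.degree (inj₂ v) ^ 3) G₂.vertices
      ≡⟨ cong₂ _+_ (cong₂ _+_
           (∑-cong (λ v → cong (_^ 3) (degree-join-original v)) G₁.vertices)
           -- Each inserted vertex contributes `2 ^ 3`, that is 8.
           (trans (∑-cong (λ i → cong (_^ 3) (degree-join-inserted i)) (allFin G₁.size))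
             (trans (∑-const 8 (allFin G₁.size)) (cong (_* 8) (length-tabulate {n = G₁.size} id)))))
           (∑-cong (λ v → cong (_^ 3) (degree-join-right v)) G₂.vertices) ⟩
    ∑ (λ v → (2 * G₁.degree v + G₂.order) ^ 3) G₁.vertices + G₁.size * 8
      + ∑ (λ v → (1 * G₂.degree v + G₁.order) ^ 3) G₂.vertices ∎

theorem3 : (G₁ G₂ : SimpleGraph) → Connected G₁ → Connected G₂ →
    (n₁ n₂ m₁ m₂ : ℕ) →
    SimpleGraph.order G₁ ≡ n₁ → SimpleGraph.order G₂ ≡ n₂ →
    SimpleGraph.size G₁ ≡ m₁ → SimpleGraph.size G₂ ≡ m₂ →
    F (vertexRJoin G₁ G₂) ≡
    8 * F G₁ + F G₂ + 12 * n₂ * M₁ G₁ + 3 * n₁ * M₁ G₂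
    + 12 * m₁ * n₂ ^ 2 + 6 * m₂ * n₁ ^ 2
    + n₁ * n₂ * (n₁ ^ 2 + n₂ ^ 2) + 8 * m₁
theorem3 G₁ G₂ _ _ n₁ n₂ m₁ m₂ refl refl refl refl =
  trans (F-join G₁ G₂)
    (trans (cong₂ (λ x y → x + m₁ * 8 + y) (∑-cubes G₁ 2 n₂) (∑-cubes G₂ 1 n₁))
      -- The coefficients 8, 12, 12 and 1, 3, 6 are the values of `a ^ 3`, `3 * a ^ 2`, `6 * a` at
      -- `a = 2` and `a = 1`. The two terms `n₁ * n₂ ^ 3` and `n₂ * n₁ ^ 3` merge into the product
      -- with `n₁ ^ 2 + n₂ ^ 2`.
      (solve 8 (λ f₁ f₂ z₁ z₂ n₁ n₂ m₁ m₂ →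
        con 8 :* f₁ :+ con 12 :* n₂ :* z₁ :+ con 12 :* n₂ :^ 2 :* m₁ :+ n₁ :* n₂ :^ 3
          :+ m₁ :* con 8
          :+ (con 1 :* f₂ :+ con 3 :* n₁ :* z₂ :+ con 6 :* n₁ :^ 2 :* m₂ :+ n₂ :* n₁ :^ 3)
        := con 8 :* f₁ :+ f₂ :+ con 12 :* n₂ :* z₁ :+ con 3 :* n₁ :* z₂
          :+ con 12 :* m₁ :* n₂ :^ 2 :+ con 6 :* m₂ :* n₁ :^ 2
          :+ n₁ :* n₂ :* (n₁ :^ 2 :+ n₂ :^ 2) :+ con 8 :* m₁)
        refl (F G₁) (F G₂) (M₁ G₁) (M₁ G₂) n₁ n₂ m₁ m₂))
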